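{- There is an infinite family $\mathcal{G}$ of graphs, each admitting both a strong rectangular layout and a rectangular dual, and constants $c_1,c_2>0$, such that every $G\in\mathcal{G}$ with $n$ vertices satisfies $A^*_s(G)\le c_1 n$ and $A^*_D(G)\ge c_2 n^2$.
   Context: A strong rectangular layout of $G=(V,E)$ is a set of axis-parallel rectangles with pairwise disjoint interiors in bijection with $V$ such that two rectangles' boundaries share a segment of positive length iff the vertices are adjacent. A rectangular dual is a partition of an axis-parallel rectangle into axis-parallel rectangles (no four meeting at a point) in bijection with $V$ such that two rectangles share a boundary segment of positive length iff the vertices are adjacent. Renderings are on the integer grid (integer corners) and the area is that of the smallest enclosing bounding box. $A^*_s(G)$ and $A^*_D(G)$ denote the minimum area of a strong rectangular layout and of a rectangular dual of $G$, respectively. -}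

module Defs where

open import Data.Nat using (ℕ; zero; suc; _+_; _*_; _∸_; _≤_; _<_; _⊓_; _⊔_)
open import Data.Fin using (Fin)
import Data.Fin as F
open import Data.Bool using (Bool; true)
open import Data.Product using (Σ; ∃; _×_; _,_)
open import Data.Sum using (_⊎_)
open import Relation.Binary.PropositionalEquality using (_≡_; _≢_)
open import Relation.Nullary using (¬_)
open import Function.Bundles using (_⇔_)

record Graph (n : ℕ) : Set where
  field
    adj     : Fin n → Fin n → Bool
    adj-sym : ∀ i j → adj i j ≡ adj j i
    adj-irr : ∀ i → ¬ (adj i i ≡ true)

Adj : ∀ {n} → Graph n → Fin n → Fin n → Set
Adj G i j = Graph.adj G i j ≡ true

record Rect : Set where
  field
    x1 x2 y1 y2 : ℕ
    x1<x2 : x1 < x2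
    y1<y2 : y1 < y2
open Rect public

InteriorDisjoint : Rect → Rect → Set
InteriorDisjoint R S =
  (x2 R ≤ x1 S) ⊎ (x2 S ≤ x1 R) ⊎ (y2 R ≤ y1 S) ⊎ (y2 S ≤ y1 R)

VSide : Rect → ℕ → Set
VSide R x = (x ≡ x1 R) ⊎ (x ≡ x2 R)

HSide : Rect → ℕ → Set
HSide R y = (y ≡ y1 R) ⊎ (y ≡ y2 R)

-- The boundaries of R and S share a segment of positive length:
-- some side of R and some side of S lie on a common line and their
-- extents along that line overlap in an interval of positive length.
ShareSegment : Rect → Rect → Set
ShareSegment R S =
  (∃ λ x → VSide R x × VSide S x × (y1 R < y2 S) × (y1 S < y2 R))
  ⊎ (∃ λ y → HSide R y × HSide S y × (x1 R < x2 S) × (x1 S < x2 R))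

PointIn : ℕ → ℕ → Rect → Set
PointIn px py R = (x1 R ≤ px) × (px ≤ x2 R) × (y1 R ≤ py) × (py ≤ y2 R)

CellIn : ℕ → ℕ → Rect → Set
CellIn a b R = (x1 R ≤ a) × (suc a ≤ x2 R) × (y1 R ≤ b) × (suc b ≤ y2 R)

_⊆R_ : Rect → Rect → Set
R ⊆R S = (x1 S ≤ x1 R) × (x2 R ≤ x2 S) × (y1 S ≤ y1 R) × (y2 R ≤ y2 S)

minF : ∀ {n} → (Fin n → ℕ) → ℕ
minF {zero} f = 0
minF {suc zero} f = f F.zero
minF {suc (suc n)} f = f F.zero ⊓ minF (λ i → f (F.suc i))

maxF : ∀ {n} → (Fin n → ℕ) → ℕ
maxF {zero} f = 0
maxF {suc n} f = f F.zero ⊔ maxF (λ i → f (F.suc i))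

bboxArea : ∀ {n} → (Fin n → Rect) → ℕ
bboxArea r =
  (maxF (λ i → x2 (r i)) ∸ minF (λ i → x1 (r i)))
  * (maxF (λ i → y2 (r i)) ∸ minF (λ i → y1 (r i)))

record StrongLayout {n : ℕ} (G : Graph n) : Set where
  field
    rect     : Fin n → Rect
    disjoint : ∀ i j → i ≢ j → InteriorDisjoint (rect i) (rect j)
    contact  : ∀ i j → i ≢ j → (ShareSegment (rect i) (rect j) ⇔ Adj G i j)

record RectDual {n : ℕ} (G : Graph n) : Set where
  field
    rect     : Fin n → Rect
    outer    : Rect
    inside   : ∀ i → rect i ⊆R outer
    covers   : ∀ a b → CellIn a b outer → ∃ λ i → CellIn a b (rect i)
    disjoint : ∀ i j → i ≢ j → InteriorDisjoint (rect i) (rect j)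
    no-four  : ∀ px py (i j k l : Fin n) →
               i ≢ j → i ≢ k → i ≢ l → j ≢ k → j ≢ l → k ≢ l →
               ¬ (PointIn px py (rect i) × PointIn px py (rect j)
                  × PointIn px py (rect k) × PointIn px py (rect l))
    contact  : ∀ i j → i ≢ j → (ShareSegment (rect i) (rect j) ⇔ Adj G i j)

module Submission where

-- The graph is the path 0 – 1 – … – 2k in which the hub k is also joined to every i < k.  Stacking
-- the vertices i < k beside the hub and continuing the stack with the tail j > k gives a strong
-- layout in two columns.  In a rectangular dual, a rectangle in no triangle of the graph spans the
-- outer rectangle in one direction: otherwise one of its corners is interior, and as at most three
-- rectangles meet there, two of its neighbours touch.  So the k tail rectangles all span, in the
-- same direction, say vertically; hence the width is at least k and the hub, caught next to a
-- spanning tail rectangle, spans too.  The k vertices i < k then lie along a single side of the hub, so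
-- the height is at least k.

open import Defs
open import Data.Nat using (ℕ; zero; suc; pred; _+_; _*_; _∸_; _≤_; _<_; z≤n; s≤s; z<s; s≤s⁻¹)
open import Data.Nat.Properties
open import Data.Fin using (Fin; toℕ; fromℕ<; _↑ˡ_; _↑ʳ_)
import Data.Fin as F
import Data.Fin.Properties as F
open import Data.Bool using (true)
open import Data.Bool.Properties using (∨-comm)
open import Data.Product using (Σ; ∃; ∃₂; _×_; _,_; proj₁; proj₂)
open import Data.Sum using (_⊎_; inj₁; inj₂; [_,_]′; swap)
open import Data.Empty using (⊥; ⊥-elim)
open import Function using (_∘_)
open import Function.Bundles using (_⇔_; mk⇔; Equivalence)
open import Function.Definitions using (Injective)
open import Relation.Nullary using (¬_; Dec; yes; no; does; contradiction)
open import Relation.Nullary.Decidable using (dec-true; _⊎-dec_; _×-dec_)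
open import Relation.Binary.Definitions using (tri<; tri≈; tri>)
open import Relation.Binary.PropositionalEquality

-- Counting and bounding boxes.

injective⇒≤∸ : ∀ {k m M} (f : Fin k → ℕ) → Injective _≡_ _≡_ f →
               (∀ i → m ≤ f i) → (∀ i → f i < M) → k ≤ M ∸ m
injective⇒≤∸ f inj m≤f f<M = F.injective⇒≤ {f = λ i → fromℕ< (∸-monoˡ-< (f<M i) (m≤f i))}
  λ {i} {j} eq → inj (∸-cancelʳ-≡ (m≤f i) (m≤f j) (F.fromℕ<-injective _ _ _ _ eq))

minF-≤ : ∀ {n} (f : Fin n → ℕ) i → minF f ≤ f i
minF-≤ {suc zero}    f F.zero    = ≤-refl
minF-≤ {suc (suc n)} f F.zero    = m⊓n≤m _ _
minF-≤ {suc (suc n)} f (F.suc i) = ≤-trans (m⊓n≤n (f F.zero) _) (minF-≤ (f ∘ F.suc) i)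

≤-maxF : ∀ {n} (f : Fin n → ℕ) i → f i ≤ maxF f
≤-maxF f F.zero    = m≤m⊔n _ _
≤-maxF f (F.suc i) = ≤-trans (≤-maxF (f ∘ F.suc) i) (m≤n⊔m (f F.zero) _)

maxF-≤ : ∀ {n b} (f : Fin n → ℕ) → (∀ i → f i ≤ b) → maxF f ≤ b
maxF-≤ {zero}  f f≤b = z≤n
maxF-≤ {suc n} f f≤b = ⊔-lub (f≤b F.zero) (maxF-≤ (f ∘ F.suc) (f≤b ∘ F.suc))

bboxArea-≤ : ∀ {n a b} (r : Fin n → Rect) → (∀ i → x2 (r i) ≤ a) → (∀ i → y2 (r i) ≤ b) →
             bboxArea r ≤ a * b
bboxArea-≤ r wide tall = *-mono-≤
  (≤-trans (m∸n≤m _ (minF (x1 ∘ r))) (maxF-≤ (x2 ∘ r) wide))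
  (≤-trans (m∸n≤m _ (minF (y1 ∘ r))) (maxF-≤ (y2 ∘ r) tall))

-- For an upper coordinate `n` of a rectangle, `a` indexes the last unit cell before it.
<⇒suc : ∀ {m n} → m < n → ∃ λ a → n ≡ suc a × m ≤ a
<⇒suc (s≤s m≤a) = _ , refl , m≤a

-- Contacts of rectangles

transpose : Rect → Rect
transpose R = record
  { x1 = y1 R ; x2 = y2 R ; y1 = x1 R ; y2 = x2 R ; x1<x2 = y1<y2 R ; y1<y2 = x1<x2 R }

ShareSegment-sym : ∀ {R S} → ShareSegment R S → ShareSegment S R
ShareSegment-sym (inj₁ (x , p , q , a , b)) = inj₁ (x , q , p , b , a)
ShareSegment-sym (inj₂ (y , p , q , a , b)) = inj₂ (y , q , p , b , a)

InteriorDisjoint-sym : ∀ {R S} → InteriorDisjoint R S → InteriorDisjoint S R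
InteriorDisjoint-sym (inj₁ p)               = inj₂ (inj₁ p)
InteriorDisjoint-sym (inj₂ (inj₁ p))        = inj₁ p
InteriorDisjoint-sym (inj₂ (inj₂ (inj₁ p))) = inj₂ (inj₂ (inj₂ p))
InteriorDisjoint-sym (inj₂ (inj₂ (inj₂ p))) = inj₂ (inj₂ (inj₁ p))

InteriorDisjoint-transpose : ∀ {R S} → InteriorDisjoint R S →
                             InteriorDisjoint (transpose R) (transpose S)
InteriorDisjoint-transpose (inj₁ p)               = inj₂ (inj₂ (inj₁ p))
InteriorDisjoint-transpose (inj₂ (inj₁ p))        = inj₂ (inj₂ (inj₂ p))
InteriorDisjoint-transpose (inj₂ (inj₂ (inj₁ p))) = inj₁ p
InteriorDisjoint-transpose (inj₂ (inj₂ (inj₂ p))) = inj₂ (inj₁ p)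

abut-x : ∀ {R S} → x2 R ≡ x1 S → y1 R < y2 S → y1 S < y2 R → ShareSegment R S
abut-x eq p q = inj₁ (_ , inj₂ refl , inj₁ eq , p , q)

abut-y : ∀ {R S} → y2 R ≡ y1 S → x1 R < x2 S → x1 S < x2 R → ShareSegment R S
abut-y eq p q = inj₂ (_ , inj₂ refl , inj₁ eq , p , q)

-- A contact along a horizontal line would need `x1 S < x2 R`. Among the vertical sides, positive
-- widths rule out every coincidence except right side of `R` with left side of `S`.
left-contact : ∀ {R S} → x2 R ≤ x1 S → ShareSegment R S → x2 R ≡ x1 S
left-contact {R} {S} le (inj₁ (x , inj₁ refl , inj₁ eq , _)) =
  contradiction eq (<⇒≢ (<-≤-trans (x1<x2 R) le))
left-contact {R} {S} le (inj₁ (x , inj₁ refl , inj₂ eq , _)) =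
  contradiction eq (<⇒≢ (<-trans (<-≤-trans (x1<x2 R) le) (x1<x2 S)))
left-contact le (inj₁ (x , inj₂ refl , inj₁ eq , _)) = eq
left-contact {R} {S} le (inj₁ (x , inj₂ refl , inj₂ eq , _)) =
  contradiction eq (<⇒≢ (≤-<-trans le (x1<x2 S)))
left-contact le (inj₂ (_ , _ , _ , _ , lt)) = contradiction lt (≤⇒≯ le)

below-contact : ∀ {R S} → y2 R ≤ y1 S → ShareSegment R S → y2 R ≡ y1 S
below-contact {R} {S} le s = left-contact {transpose R} {transpose S} le (swap s)

-- Lower bounds for rectangular duals

TriangleFreeAt : ∀ {n} → Graph n → Fin n → Set
TriangleFreeAt G c = ∀ u v → Adj G c u → Adj G c v → ¬ Adj G u v

Adj-sym : ∀ {n} (G : Graph n) {i j} → Adj G i j → Adj G j i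
Adj-sym G {i} {j} = trans (Graph.adj-sym G j i)

-- What can be said about the owners q₀, …, q₃ of the four unit cells around an interior grid
-- point, listed cyclically.
record CellCycle {n} (G : Graph n) (q₀ q₁ q₂ q₃ : Fin n) : Set where
  field
    link₀₁ : q₀ ≢ q₁ → Adj G q₀ q₁
    link₁₂ : q₁ ≢ q₂ → Adj G q₁ q₂
    link₂₃ : q₂ ≢ q₃ → Adj G q₂ q₃
    link₃₀ : q₃ ≢ q₀ → Adj G q₃ q₀
    diag₀₂ : q₀ ≡ q₂ → q₀ ≡ q₁ × q₀ ≡ q₃
    diag₁₃ : q₁ ≡ q₃ → q₁ ≡ q₀ × q₁ ≡ q₂
    pinch  : q₀ ≢ q₁ → q₁ ≢ q₂ → q₂ ≢ q₃ → ¬ (q₃ ≢ q₀)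

-- Reduces the four corners of a rectangle to the one treated in `no-corner`.
rotate : ∀ {n} {G : Graph n} {q₀ q₁ q₂ q₃} → CellCycle G q₀ q₁ q₂ q₃ → CellCycle G q₁ q₂ q₃ q₀
rotate C = record
  { link₀₁ = link₁₂ ; link₁₂ = link₂₃ ; link₂₃ = link₃₀ ; link₃₀ = link₀₁
  ; diag₀₂ = λ e → let (p , q) = diag₁₃ e in q , p
  ; diag₁₃ = λ e → let (p , q) = diag₀₂ (sym e) in trans e p , trans e q
  ; pinch  = λ a b c d → pinch d a b c
  } where open CellCycle C

-- Both `q₁` and `q₃` are adjacent to `q₀`. If `q₂` equals exactly one of them, it is adjacent to
-- the other, which closes a triangle at `q₀`. If it equals both, `diag₁₃` makes `q₀` equal to them
-- too; if neither, four rectangles meet at the point.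
no-corner : ∀ {n} {G : Graph n} {q₀ q₁ q₂ q₃} → CellCycle G q₀ q₁ q₂ q₃ →
            TriangleFreeAt G q₀ → q₀ ≢ q₁ → ¬ (q₃ ≢ q₀)
no-corner {G = G} {q₁ = q₁} {q₂} {q₃} C free q₀≢q₁ q₃≢q₀ with q₁ F.≟ q₂ | q₂ F.≟ q₃
... | yes refl | yes refl = q₀≢q₁ (sym (proj₁ (CellCycle.diag₁₃ C refl)))
... | yes refl | no  ne   =
  free _ _ (CellCycle.link₀₁ C q₀≢q₁) (Adj-sym G (CellCycle.link₃₀ C q₃≢q₀)) (CellCycle.link₂₃ C ne)
... | no  ne   | yes refl =
  free _ _ (CellCycle.link₀₁ C q₀≢q₁) (Adj-sym G (CellCycle.link₃₀ C q₃≢q₀)) (CellCycle.link₁₂ C ne)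
... | no  ne   | no  ne′  = CellCycle.pinch C q₀≢q₁ ne ne′ q₃≢q₀

-- Lets every statement about one axis be used for the other.
transposeDual : ∀ {n} {G : Graph n} → RectDual G → RectDual G
transposeDual D = record
  { rect     = transpose ∘ rect
  ; outer    = transpose outer
  ; inside   = λ i → let (a , b , c , d) = inside i in c , d , a , b
  ; covers   = λ { a b (p , q , r , s) →
                 let (i , p , q , r , s) = covers b a (r , s , p , q) in i , r , s , p , q }
  ; disjoint = λ i j ne → InteriorDisjoint-transpose {rect i} {rect j} (disjoint i j ne)
  ; no-four  = λ { px py i j k l a b c d e f (p , q , r , s) →
                 no-four py px i j k l a b c d e f (flip p , flip q , flip r , flip s) }
  ; contact  = λ i j ne → mk⇔ (Equivalence.to (contact i j ne) ∘ swap)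
                              (swap ∘ Equivalence.from (contact i j ne))
  }
  where
  open RectDual D
  flip : ∀ {A B C E : Set} → A × B × C × E → C × E × A × B
  flip (a , b , c , d) = c , d , a , b

-- Owners of unit cells.

module _ {n : ℕ} {G : Graph n} (D : RectDual G) where
  open RectDual D

  same-cell : ∀ {i j a b} → CellIn a b (rect i) → CellIn a b (rect j) → i ≡ j
  same-cell {i} {j} (p , q , r , s) (p′ , q′ , r′ , s′) with i F.≟ j
  ... | yes eq = eq
  ... | no  ne with disjoint i j ne
  ...   | inj₁ le               = contradiction (≤-trans (≤-trans q le) p′) 1+n≰n
  ...   | inj₂ (inj₁ le)        = contradiction (≤-trans (≤-trans q′ le) p) 1+n≰n
  ...   | inj₂ (inj₂ (inj₁ le)) = contradiction (≤-trans (≤-trans s le) r′) 1+n≰n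
  ...   | inj₂ (inj₂ (inj₂ le)) = contradiction (≤-trans (≤-trans s′ le) r) 1+n≰n

  -- The two rectangles share row `b`, so only a vertical line can separate them. That line is
  -- forced to be `x = a + 1`, and the shared row gives a contact of positive length.
  neighbour-x : ∀ {i j a b} → CellIn a b (rect i) → CellIn (suc a) b (rect j) →
                i ≢ j → Adj G i j
  neighbour-x {i} {j} (p , q , r , s) (p′ , q′ , r′ , s′) ne with disjoint i j ne
  ... | inj₁ le = Equivalence.to (contact i j ne)
      (abut-x {rect i} {rect j} (≤-antisym le (≤-trans p′ q)) (≤-<-trans r s′) (≤-<-trans r′ s))
  ... | inj₂ (inj₁ le) =
      contradiction (≤-trans (≤-trans (<-trans (n<1+n _) q′) le) p) 1+n≰n
  ... | inj₂ (inj₂ (inj₁ le)) = contradiction (≤-trans (≤-trans s le) r′) 1+n≰n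
  ... | inj₂ (inj₂ (inj₂ le)) = contradiction (≤-trans (≤-trans s′ le) r) 1+n≰n

module _ {n : ℕ} {G : Graph n} (D : RectDual G) where
  open RectDual D

  neighbour-y : ∀ {i j a b} → CellIn a b (rect i) → CellIn a (suc b) (rect j) →
                i ≢ j → Adj G i j
  neighbour-y (p , q , r , s) (p′ , q′ , r′ , s′) =
    neighbour-x (transposeDual D) (r , s , p , q) (r′ , s′ , p′ , q′)

  cellCycle : ∀ {a b i j k l} →
              CellIn a b (rect i) → CellIn (suc a) b (rect j) →
              CellIn (suc a) (suc b) (rect k) → CellIn a (suc b) (rect l) → CellCycle G i j k l
  cellCycle {a} {b} {i} {j} {k} {l} I@(i₁ , i₂ , i₃ , i₄) J@(j₁ , j₂ , j₃ , j₄)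
            K@(k₁ , k₂ , k₃ , k₄) L@(l₁ , l₂ , l₃ , l₄) = record
    { link₀₁ = neighbour-x D I J
    ; link₁₂ = neighbour-y J K
    ; link₂₃ = λ ne → Adj-sym G (neighbour-x D L K (ne ∘ sym))
    ; link₃₀ = λ ne → Adj-sym G (neighbour-y I L (ne ∘ sym))
    -- By convexity, a rectangle owning two opposite cells of the block owns all four.
    ; diag₀₂ = λ { refl → same-cell D (m≤n⇒m≤1+n i₁ , k₂ , i₃ , i₄) J
                        , same-cell D (i₁ , i₂ , m≤n⇒m≤1+n i₃ , k₄) L }
    ; diag₁₃ = λ { refl → same-cell D (l₁ , l₂ , j₃ , j₄) I , same-cell D (j₁ , j₂ , l₃ , l₄) K }
    ; pinch  = pinch
    }
    where
    pinch : i ≢ j → j ≢ k → k ≢ l → ¬ (l ≢ i)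
    -- The common corner of the four cells lies in all four owners; opposite owners are distinct by
    -- the same convexity argument.
    pinch i≢j j≢k k≢l l≢i = no-four (suc a) (suc b) i j k l
      i≢j
      (λ { refl → i≢j (same-cell D (m≤n⇒m≤1+n i₁ , k₂ , i₃ , i₄) J) })
      (l≢i ∘ sym) j≢k
      (λ { refl → i≢j (same-cell D I (l₁ , l₂ , j₃ , j₄)) })
      k≢l
      ( (m≤n⇒m≤1+n i₁ , i₂ , m≤n⇒m≤1+n i₃ , i₄)
      , (j₁ , <⇒≤ j₂ , m≤n⇒m≤1+n j₃ , j₄)
      , (k₁ , <⇒≤ k₂ , k₃ , <⇒≤ k₄)
      , (m≤n⇒m≤1+n l₁ , l₂ , l₃ , <⇒≤ l₄) )

  cellsAround : ∀ {a b} → x1 outer ≤ a → suc a < x2 outer → y1 outer ≤ b → suc b < y2 outer →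
                ∃₂ λ i j → ∃₂ λ k l →
                CellIn a b (rect i) × CellIn (suc a) b (rect j) ×
                CellIn (suc a) (suc b) (rect k) × CellIn a (suc b) (rect l)
  cellsAround {a} {b} p q r s =
    let (i , ci) = covers a b (p , <⇒≤ q , r , <⇒≤ s)
        (j , cj) = covers (suc a) b (m≤n⇒m≤1+n p , q , r , <⇒≤ s)
        (k , ck) = covers (suc a) (suc b) (m≤n⇒m≤1+n p , q , m≤n⇒m≤1+n r , s)
        (l , cl) = covers a (suc b) (p , <⇒≤ q , m≤n⇒m≤1+n r , s)
    in i , j , k , l , ci , cj , ck , cl

  -- Rectangles spanning the outer rectangle.

  SpansX SpansY : Fin n → Set
  SpansX i = x1 (rect i) ≤ x1 outer × x2 outer ≤ x2 (rect i)
  SpansY i = y1 (rect i) ≤ y1 outer × y2 outer ≤ y2 (rect i)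

  -- The line x = a + 1 carries the right side (inj₁) or the left side (inj₂) of rectangle c and
  -- runs through the interior of the outer rectangle.
  InteriorSideX InteriorSideY : Fin n → ℕ → Set
  InteriorSideX c a = x1 outer ≤ a × suc a < x2 outer ×
    ((x1 (rect c) ≤ a × x2 (rect c) ≡ suc a) ⊎ (x1 (rect c) ≡ suc a × suc a < x2 (rect c)))
  InteriorSideY c b = y1 outer ≤ b × suc b < y2 outer ×
    ((y1 (rect c) ≤ b × y2 (rect c) ≡ suc b) ⊎ (y1 (rect c) ≡ suc b × suc b < y2 (rect c)))

  -- The two side lines cross at a corner of `c`, and exactly one of the four cells around that
  -- point belongs to `c`. The four cases are the four corners; the rotations bring the cell of `c`
  -- to the front for `no-corner`.
  no-interior-corner : ∀ {c a b} → TriangleFreeAt G c → InteriorSideX c a → ¬ InteriorSideY c b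
  no-interior-corner {c} {a} {b} free (p , q , X) (r , s , Y)
    with (i , j , k , l , ci , cj , ck , cl) ← cellsAround p q r s = go X Y
    where
    cycle = cellCycle ci cj ck cl

    go : _ → _ → ⊥
    go (inj₁ (le , eq)) (inj₁ (le′ , eq′))
      with refl ← same-cell D ci (le , ≤-reflexive (sym eq) , le′ , ≤-reflexive (sym eq′)) =
      no-corner cycle free
        (λ { refl → <⇒≱ (proj₁ (proj₂ cj)) (≤-reflexive eq) })
        (λ { refl → <⇒≱ (proj₂ (proj₂ (proj₂ cl))) (≤-reflexive eq′) })
    go (inj₂ (eq , lt)) (inj₁ (le′ , eq′))
      with refl ← same-cell D cj (≤-reflexive eq , lt , le′ , ≤-reflexive (sym eq′)) =
      no-corner (rotate cycle) free
        (λ { refl → <⇒≱ (proj₂ (proj₂ (proj₂ ck))) (≤-reflexive eq′) })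
        (λ { refl → <⇒≱ (≤-reflexive (sym eq)) (proj₁ ci) })
    go (inj₂ (eq , lt)) (inj₂ (eq′ , lt′))
      with refl ← same-cell D ck (≤-reflexive eq , lt , ≤-reflexive eq′ , lt′) =
      no-corner (rotate (rotate cycle)) free
        (λ { refl → <⇒≱ (≤-reflexive (sym eq)) (proj₁ cl) })
        (λ { refl → <⇒≱ (≤-reflexive (sym eq′)) (proj₁ (proj₂ (proj₂ cj))) })
    go (inj₁ (le , eq)) (inj₂ (eq′ , lt′))
      with refl ← same-cell D cl (le , ≤-reflexive (sym eq) , ≤-reflexive eq′ , lt′) =
      no-corner (rotate (rotate (rotate cycle))) free
        (λ { refl → <⇒≱ (≤-reflexive (sym eq′)) (proj₁ (proj₂ (proj₂ ci))) })
        (λ { refl → <⇒≱ (proj₁ (proj₂ ck)) (≤-reflexive eq) })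

  spansX? : ∀ c → SpansX c ⊎ ∃ (InteriorSideX c)
  spansX? c with inside c | x1 (rect c) ≤? x1 outer | x2 outer ≤? x2 (rect c)
  ... | _         | yes p | yes q = inj₁ (p , q)
  ... | l , r , _ | no  p | _     with (a , eq , le) ← <⇒suc (≰⇒> p) =
    inj₂ (a , le , <-≤-trans lt r , inj₂ (eq , lt))
    where lt = subst (_< x2 (rect c)) eq (x1<x2 (rect c))
  ... | l , r , _ | yes _ | no  q with (a , eq , le) ← <⇒suc (x1<x2 (rect c)) =
    inj₂ (a , ≤-trans l le , subst (_< x2 outer) eq (≰⇒> q) , inj₁ (le , eq))

module _ {n : ℕ} {G : Graph n} (D : RectDual G) where
  open RectDual D

  -- A rectangle spanning in neither direction has an interior vertical side and an interior
  -- horizontal side, and these meet in an interior corner.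
  spans : ∀ {c} → TriangleFreeAt G c → SpansX D c ⊎ SpansY D c
  spans {c} free with spansX? D c | spansX? (transposeDual D) c
  ... | inj₁ s       | _            = inj₁ s
  ... | inj₂ _       | inj₁ s       = inj₂ s
  ... | inj₂ (_ , X) | inj₂ (_ , Y) = ⊥-elim (no-interior-corner D free X Y)

  -- Both rectangles own the cell with coordinates `x1 (rect j)` and `y1 (rect i)`.
  crossing-spans : ∀ {i j} → SpansX D i → SpansY D j → i ≡ j
  crossing-spans {i} {j} (p , q) (r , s) =
    let (xj₁ , xj₂ , _) = inside j
        (_ , _ , yi₁ , yi₂) = inside i
    in same-cell D
         (≤-trans p xj₁ , ≤-trans (<-≤-trans (x1<x2 (rect j)) xj₂) q , ≤-refl , y1<y2 (rect i))
         (≤-refl , x1<x2 (rect j) , ≤-trans r yi₁ , ≤-trans (<-≤-trans (y1<y2 (rect i)) yi₂) s)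

  ColumnIn : ℕ → Fin n → Set
  ColumnIn a i = x1 (rect i) ≤ a × a < x2 (rect i)

  same-column : ∀ {i j a} → SpansY D i → ColumnIn a i → ColumnIn a j → i ≡ j
  same-column {i} {j} (r , s) (p , q) (p′ , q′) =
    let (_ , _ , y₁ , y₂) = inside j
    in same-cell D (p , q , ≤-trans r y₁ , ≤-trans (<-≤-trans (y1<y2 (rect j)) y₂) s)
                   (p′ , q′ , ≤-refl , y1<y2 (rect j))

  spanning-abut : ∀ {i j} → SpansY D i → i ≢ j →
                  (x2 (rect i) ≡ x1 (rect j)) ⊎ (x2 (rect j) ≡ x1 (rect i)) → Adj G i j
  spanning-abut {i} {j} (r , s) ne side = Equivalence.to (contact i j ne) (share side)
    where
    y₁ = proj₁ (proj₂ (proj₂ (inside j)))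
    y₂ = proj₂ (proj₂ (proj₂ (inside j)))
    up : y1 (rect i) < y2 (rect j)
    up = ≤-<-trans (≤-trans r y₁) (y1<y2 (rect j))
    down : y1 (rect j) < y2 (rect i)
    down = <-≤-trans (y1<y2 (rect j)) (≤-trans y₂ s)
    share : _ → ShareSegment (rect i) (rect j)
    share (inj₁ eq) = abut-x {rect i} {rect j} eq up down
    share (inj₂ eq) = ShareSegment-sym {rect j} {rect i} (abut-x {rect j} {rect i} eq down up)

  -- A rectangle spanning vertically leaves no room above or below itself, so any contact is along a
  -- vertical side.
  beside : ∀ {i j} → SpansY D i → i ≢ j → Adj G i j →
           (x2 (rect i) ≡ x1 (rect j)) ⊎ (x2 (rect j) ≡ x1 (rect i))
  beside {i} {j} (r , s) ne adj with disjoint i j ne | Equivalence.from (contact i j ne) adj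
  ... | inj₁ le        | sh = inj₁ (left-contact {rect i} {rect j} le sh)
  ... | inj₂ (inj₁ le) | sh =
    inj₂ (left-contact {rect j} {rect i} le (ShareSegment-sym {rect i} {rect j} sh))
  ... | inj₂ (inj₂ (inj₁ le)) | _ =
    contradiction (<-≤-trans (y1<y2 (rect j)) (≤-trans (proj₂ (proj₂ (proj₂ (inside j)))) s)) (≤⇒≯ le)
  ... | inj₂ (inj₂ (inj₂ le)) | _ =
    contradiction (≤-<-trans (≤-trans r (proj₁ (proj₂ (proj₂ (inside j))))) (y1<y2 (rect j))) (≤⇒≯ le)

  -- The witness is the column just outside c on b's side.
  column-owners : ∀ {c b} → SpansY D c → c ≢ b → Adj G c b →
                  ∃ λ a → ColumnIn a b × (∀ z → z ≢ c → ColumnIn a z → Adj G c z)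
  column-owners {c} {b} sc c≢b adj with beside sc c≢b adj
  ... | inj₁ eq = x1 (rect b) , (≤-refl , x1<x2 (rect b)) , λ z z≢c (p , q) →
    spanning-abut sc (z≢c ∘ sym) (inj₁ (≤-antisym
      -- If `z` began left of the right side of `c`, it would own cells in the last column of `c`,
      -- which belongs entirely to `c`.
      (≮⇒≥ λ lt → let (a , ea , le) = <⇒suc (x1<x2 (rect c)) in
        z≢c (sym (same-column {a = a} sc (le , ≤-reflexive (sym ea))
          ( s≤s⁻¹ (subst (x1 (rect z) <_) ea lt)
          , ≤-trans (≤-reflexive (sym ea)) (≤-trans (≤-reflexive eq) (<⇒≤ q))))))
      (≤-trans p (≤-reflexive (sym eq)))))
  ... | inj₂ eq with (a , ea , le) ← <⇒suc (x1<x2 (rect b)) =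
    a , (le , ≤-reflexive (sym ea)) , λ z z≢c (p , q) →
    spanning-abut sc (z≢c ∘ sym) (inj₂ (≤-antisym
      (≮⇒≥ λ lt → z≢c (sym (same-column sc (≤-refl , x1<x2 (rect c))
        (≤-trans p (≤-trans (n≤1+n a) (≤-reflexive (trans (sym ea) eq))) , lt))))
      (≤-trans (≤-reflexive (trans (sym eq) ea)) q)))

  -- In the column just outside `c`, every owner touches `c`, so it is `b` or spans. A spanning
  -- owner fills that column, which already contains cells of `b`, so it is `b` again. Thus `b` owns
  -- the column from bottom to top.
  spans-beside : ∀ {c b} → SpansY D c → c ≢ b → Adj G c b →
                 (∀ z → Adj G c z → z ≡ b ⊎ SpansY D z) → SpansY D b
  spans-beside {c} {b} sc c≢b adj nbrs
    with (a , col@(p , q) , owners) ← column-owners sc c≢b adj =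
      -- The lowest cell of the column fixes the lower side of `b`, the highest cell its upper side.
      proj₁ (proj₂ (proj₂ (at (y1 outer) ≤-refl (y1<y2 outer))))
    , (let (t , et , le) = <⇒suc (y1<y2 outer)
       in ≤-trans (≤-reflexive et) (proj₂ (proj₂ (proj₂ (at t le (≤-reflexive (sym et)))))))
    where
    at : ∀ t → y1 outer ≤ t → t < y2 outer → CellIn a t (rect b)
    at t r s with (x₁ , x₂ , _) ← inside b
             with (z , cz@(p′ , q′ , _)) ← covers a t (≤-trans x₁ p , ≤-trans q x₂ , r , s)
             with z F.≟ c
    ... | yes refl = ⊥-elim (c≢b (same-column sc (p′ , q′) col))
    ... | no  z≢c with nbrs z (owners z z≢c (p′ , q′))
    ...   | inj₁ refl = cz
    ...   | inj₂ sz   with refl ← same-column sz (p′ , q′) col = cz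

  common-column : ∀ {u v} → x1 (rect u) ≡ x1 (rect v) ⊎ x2 (rect u) ≡ x2 (rect v) →
                  ∃ λ a → ColumnIn a u × ColumnIn a v
  common-column {u} {v} (inj₁ eq) =
    x1 (rect v) , (≤-reflexive eq , subst (_< x2 (rect u)) eq (x1<x2 (rect u))) , ≤-refl , x1<x2 (rect v)
  common-column {u} {v} (inj₂ eq)
    with (a , eu , le) ← <⇒suc (x1<x2 (rect u)) | (a′ , ev , le′) ← <⇒suc (x1<x2 (rect v))
    with refl ← suc-injective (trans (sym eu) (trans eq ev)) =
    a , (le , ≤-reflexive (sym eu)) , le′ , ≤-reflexive (sym ev)

  -- The rectangles touching a spanning b all lie on the side of b away from the spanning c, so
  -- two of them with the same lower side would overlap.
  heights-distinct : ∀ {b c u v} → SpansY D b → SpansY D c → b ≢ c → b ≢ u → b ≢ v →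
                     c ≢ u → c ≢ v → Adj G b c → Adj G b u → Adj G b v →
                     y1 (rect u) ≡ y1 (rect v) → u ≡ v
  heights-distinct {b} {c} {u} {v} sb sc b≢c b≢u b≢v c≢u c≢v bc bu bv eq =
    sides (beside sb b≢c bc) (beside sb b≢u bu) (beside sb b≢v bv)
    where
    apart : ∀ {i} → c ≢ i → ¬ (x1 (rect c) ≡ x1 (rect i) ⊎ x2 (rect c) ≡ x2 (rect i))
    apart c≢i e = let (_ , p , q) = common-column e in c≢i (same-column sc p q)

    together : x1 (rect u) ≡ x1 (rect v) ⊎ x2 (rect u) ≡ x2 (rect v) → u ≡ v
    together e = let (_ , (p , q) , (p′ , q′)) = common-column e in
      same-cell D (p , q , ≤-reflexive eq , subst (_< y2 (rect u)) eq (y1<y2 (rect u)))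
                  (p′ , q′ , ≤-refl , y1<y2 (rect v))

    Side : Fin n → Set
    Side i = (x2 (rect b) ≡ x1 (rect i)) ⊎ (x2 (rect i) ≡ x1 (rect b))

    sides : Side c → Side u → Side v → u ≡ v
    sides (inj₁ ec) (inj₁ eu) _         = ⊥-elim (apart c≢u (inj₁ (trans (sym ec) eu)))
    sides (inj₁ ec) (inj₂ _)  (inj₁ ev) = ⊥-elim (apart c≢v (inj₁ (trans (sym ec) ev)))
    sides (inj₂ ec) (inj₂ eu) _         = ⊥-elim (apart c≢u (inj₂ (trans ec (sym eu))))
    sides (inj₂ ec) (inj₁ _)  (inj₂ ev) = ⊥-elim (apart c≢v (inj₂ (trans ec (sym ev))))
    sides (inj₁ _)  (inj₂ eu) (inj₂ ev) = together (inj₂ (trans eu (sym ev)))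
    sides (inj₂ _)  (inj₁ eu) (inj₁ ev) = together (inj₁ (trans (sym eu) ev))

-- The graph and its two representations

-- Edges run from the smaller to the larger endpoint. The edge from `k - 1` to `k` satisfies both
-- alternatives.
Up : ℕ → ℕ → ℕ → Set
Up k i j = j ≡ suc i ⊎ (j ≡ k × i < k)

Edge : ℕ → ℕ → ℕ → Set
Edge k i j = Up k i j ⊎ Up k j i

up? : ∀ k i j → Dec (Up k i j)
up? k i j = (j ≟ suc i) ⊎-dec ((j ≟ k) ×-dec (i <? k))

edge? : ∀ k i j → Dec (Edge k i j)
edge? k i j = up? k i j ⊎-dec up? k j i

up⇒< : ∀ {k i j} → Up k i j → i < j
up⇒< (inj₁ refl)         = n<1+n _
up⇒< (inj₂ (refl , i<k)) = i<k

edge-irr : ∀ {k i} → ¬ Edge k i i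
edge-irr = [ <-irrefl refl ∘ up⇒< , <-irrefl refl ∘ up⇒< ]′

does⇒ : ∀ {A : Set} (a? : Dec A) → does a? ≡ true → A
does⇒ (yes a) _ = a

-- The sum `k + suc k` separates the `k` leaves from the hub followed by the `k` tail vertices.
fan : ∀ k → Graph (k + suc k)
fan k = record
  { adj     = λ i j → does (edge? k (toℕ i) (toℕ j))
  ; adj-sym = λ i j → ∨-comm (does (up? k (toℕ i) (toℕ j))) _
  ; adj-irr = λ i → edge-irr ∘ does⇒ (edge? k (toℕ i) (toℕ i))
  }

adj⇒edge : ∀ {k i j} → Adj (fan k) i j → Edge k (toℕ i) (toℕ j)
adj⇒edge {k} {i} {j} = does⇒ (edge? k (toℕ i) (toℕ j))

edge⇒adj : ∀ {k i j} → Edge k (toℕ i) (toℕ j) → Adj (fan k) i j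
edge⇒adj {k} {i} {j} = dec-true (edge? k (toℕ i) (toℕ j))

-- Common to both representations: on natural-number indices, the geometry is checked only for
-- increasing pairs and edges, and symmetry supplies the rest.
record Realises (k : ℕ) (r : ℕ → Rect) : Set where
  field
    disjoint : ∀ {i j} → i < j → InteriorDisjoint (r i) (r j)
    share⇒up : ∀ {i j} → i < j → ShareSegment (r i) (r j) → Up k i j
    up⇒share : ∀ {i j} → Up k i j → ShareSegment (r i) (r j)

  disjoint-≢ : ∀ {i j} → i ≢ j → InteriorDisjoint (r i) (r j)
  disjoint-≢ {i} {j} ne with <-cmp i j
  ... | tri< lt _ _ = disjoint lt
  ... | tri≈ _ eq _ = contradiction eq ne
  ... | tri> _ _ gt = InteriorDisjoint-sym {r j} {r i} (disjoint gt)

  share⇒edge : ∀ {i j} → i ≢ j → ShareSegment (r i) (r j) → Edge k i j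
  share⇒edge {i} {j} ne sh with <-cmp i j
  ... | tri< lt _ _ = inj₁ (share⇒up lt sh)
  ... | tri≈ _ eq _ = contradiction eq ne
  ... | tri> _ _ gt = inj₂ (share⇒up gt (ShareSegment-sym {r i} {r j} sh))

  edge⇒share : ∀ {i j} → Edge k i j → ShareSegment (r i) (r j)
  edge⇒share (inj₁ u)         = up⇒share u
  edge⇒share {i} {j} (inj₂ u) = ShareSegment-sym {r j} {r i} (up⇒share u)

  contact : ∀ (i j : Fin (k + suc k)) → i ≢ j →
            ShareSegment (r (toℕ i)) (r (toℕ j)) ⇔ Adj (fan k) i j
  contact i j ne = mk⇔ (λ sh → edge⇒adj {k} {i} {j} (share⇒edge (ne ∘ F.toℕ-injective) sh))
                       (λ a → edge⇒share (adj⇒edge {k} {i} {j} a))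

-- Coordinates of the strong layout and of the dual.

data Position (k : ℕ) : ℕ → Set where
  low  : ∀ {i} → i < k → Position k i
  hub  : Position k k
  high : ∀ {i} → k < i → Position k i

position : ∀ k i → Position k i
position k i with <-cmp i k
... | tri< lt _ _   = low lt
... | tri≈ _ refl _ = hub
... | tri> _ _ gt   = high gt

unit : ℕ → ℕ → Rect
unit x y = record
  { x1 = x ; x2 = suc x ; y1 = y ; y2 = suc y ; x1<x2 = n<1+n _ ; y1<y2 = n<1+n _ }

-- With hub height `suc k`, each tail vertex can sit at the height of its own index. The left column
-- stays empty from height `k` on, which a strong layout permits.
strongRect′ : ∀ {k i} → Position k i → Rect
strongRect′ {i = i} (low _)  = unit 0 i
strongRect′ {k} hub          = record
  { x1 = 1 ; x2 = 2 ; y1 = 0 ; y2 = suc k ; x1<x2 = n<1+n _ ; y1<y2 = z<s }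
strongRect′ {i = i} (high _) = unit 1 i

strongRect : ℕ → ℕ → Rect
strongRect k i = strongRect′ (position k i)

strong-realises : ∀ k → Realises k (strongRect k)
strong-realises k = record
  { disjoint = λ {i} {j} → disj (position k i) (position k j)
  ; share⇒up = λ {i} {j} → share⇒up (position k i) (position k j)
  ; up⇒share = λ {i} {j} → up⇒share (position k i) (position k j)
  }
  where
  disj : ∀ {i j} (p : Position k i) (q : Position k j) → i < j →
         InteriorDisjoint (strongRect′ p) (strongRect′ q)
  disj (low _)  (low _)  lt = inj₂ (inj₂ (inj₁ lt))
  disj (low _)  hub      lt = inj₁ ≤-refl
  disj (low _)  (high _) lt = inj₁ ≤-refl
  disj hub      (low p)  lt = contradiction p (<-asym lt)
  disj hub      hub      lt = contradiction lt (<-irrefl refl)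
  disj hub      (high _) lt = inj₂ (inj₂ (inj₁ lt))
  disj (high p) (low q)  lt = contradiction (<-trans lt q) (<-asym p)
  disj (high p) hub      lt = contradiction p (<-asym lt)
  disj (high _) (high _) lt = inj₂ (inj₂ (inj₁ lt))

  share⇒up : ∀ {i j} (p : Position k i) (q : Position k j) → i < j →
             ShareSegment (strongRect′ p) (strongRect′ q) → Up k i j
  share⇒up p@(low _)  q@(low _)  lt sh =
    inj₁ (sym (below-contact {strongRect′ p} {strongRect′ q} lt sh))
  share⇒up (low i<k)  hub        lt sh = inj₂ (refl , i<k)
  -- This contact never occurs, but the equation `j ≡ suc i` that it would force is already an edge.
  share⇒up p@(low _)  q@(high _) lt sh =
    inj₁ (sym (below-contact {strongRect′ p} {strongRect′ q} lt sh))
  share⇒up hub        (low p)    lt sh = contradiction p (<-asym lt)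
  share⇒up hub        hub        lt sh = contradiction lt (<-irrefl refl)
  share⇒up p@hub      q@(high _) lt sh =
    inj₁ (sym (below-contact {strongRect′ p} {strongRect′ q} lt sh))
  share⇒up (high p)   (low q)    lt sh = contradiction (<-trans lt q) (<-asym p)
  share⇒up (high p)   hub        lt sh = contradiction p (<-asym lt)
  share⇒up p@(high _) q@(high _) lt sh =
    inj₁ (sym (below-contact {strongRect′ p} {strongRect′ q} lt sh))

  up⇒share : ∀ {i j} (p : Position k i) (q : Position k j) → Up k i j →
             ShareSegment (strongRect′ p) (strongRect′ q)
  up⇒share p@(low _)  q@hub      u           =
    abut-x {strongRect′ p} {strongRect′ q} refl (<-trans (up⇒< {k} u) (n<1+n _)) z<s
  up⇒share p@(low _)  q@(low _)  (inj₁ refl) = abut-y {strongRect′ p} {strongRect′ q} refl z<s z<s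
  up⇒share (low p)    (high q)   (inj₁ refl) = contradiction q (≤⇒≯ p)
  up⇒share p@hub      q@(high _) (inj₁ refl) =
    abut-y {strongRect′ p} {strongRect′ q} refl (n<1+n _) (n<1+n _)
  up⇒share p@(high _) q@(high _) (inj₁ refl) =
    abut-y {strongRect′ p} {strongRect′ q} refl (n<1+n _) (n<1+n _)
  up⇒share hub        (low p)    u           = contradiction p (<-asym (up⇒< {k} u))
  up⇒share hub        hub        u           = contradiction (up⇒< {k} u) (<-irrefl refl)
  up⇒share (high p)   (low q)    u           = contradiction (<-trans (up⇒< {k} u) q) (<-asym p)
  up⇒share (high p)   hub        u           = contradiction p (<-asym (up⇒< {k} u))
  up⇒share (low p)    (low q)    (inj₂ (refl , _)) = contradiction q (<-irrefl refl)
  up⇒share (low p)    (high q)   (inj₂ (refl , _)) = contradiction q (<-irrefl refl)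
  up⇒share hub        (high q)   (inj₂ (_ , lt))   = contradiction lt (<-irrefl refl)
  up⇒share (high p)   (high q)   (inj₂ (_ , lt))   = contradiction p (<-asym lt)

strongLayout : ∀ k → StrongLayout (fan k)
strongLayout k = record
  { rect     = strongRect k ∘ toℕ
  ; disjoint = λ i j ne → Realises.disjoint-≢ (strong-realises k) (ne ∘ F.toℕ-injective)
  ; contact  = Realises.contact (strong-realises k)
  }

strong-area : ∀ k → bboxArea (StrongLayout.rect (strongLayout k)) ≤ 2 * (k + suc k)
strong-area k = bboxArea-≤ (strongRect k ∘ toℕ)
  (λ i → wide (position k (toℕ i))) (λ i → tall (position k (toℕ i)) (F.toℕ<n i))
  where
  wide : ∀ {i} (p : Position k i) → x2 (strongRect′ p) ≤ 2
  wide (low _)  = s≤s z≤n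
  wide hub      = ≤-refl
  wide (high _) = ≤-refl

  tall : ∀ {i} (p : Position k i) → i < k + suc k → y2 (strongRect′ p) ≤ k + suc k
  tall (low _)  lt = lt
  tall hub      lt = lt
  tall (high _) lt = lt

-- Here k = suc m, so that the rectangles have positive size.
dualRect′ : ∀ m {i} → Dec (i < suc m) → Rect
dualRect′ m {i} (yes _) = record
  { x1 = 0 ; x2 = suc m ; y1 = i ; y2 = suc i ; x1<x2 = z<s ; y1<y2 = n<1+n _ }
dualRect′ m {i} (no _)  = record
  { x1 = i ; x2 = suc i ; y1 = 0 ; y2 = suc m ; x1<x2 = n<1+n _ ; y1<y2 = z<s }

dualRect : ℕ → ℕ → Rect
dualRect m i = dualRect′ m (i <? suc m)

-- The leaves are rows of a square of side `k`, and the hub and tail are full-height columns to its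
-- right. The left side of the hub closes off all the rows.
dual-realises : ∀ m → Realises (suc m) (dualRect m)
dual-realises m = record
  { disjoint = λ {i} {j} → disj (i <? suc m) (j <? suc m)
  ; share⇒up = λ {i} {j} → share⇒up (i <? suc m) (j <? suc m)
  ; up⇒share = λ {i} {j} → up⇒share (i <? suc m) (j <? suc m)
  }
  where
  disj : ∀ {i j} (p : Dec (i < suc m)) (q : Dec (j < suc m)) → i < j →
         InteriorDisjoint (dualRect′ m p) (dualRect′ m q)
  disj (yes _) (yes _) lt = inj₂ (inj₂ (inj₁ lt))
  disj (yes _) (no q)  lt = inj₁ (≮⇒≥ q)
  disj (no p)  (yes q) lt = contradiction (<-trans lt q) p
  disj (no _)  (no _)  lt = inj₁ lt

  share⇒up : ∀ {i j} (p : Dec (i < suc m)) (q : Dec (j < suc m)) → i < j →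
             ShareSegment (dualRect′ m p) (dualRect′ m q) → Up (suc m) i j
  share⇒up p@(yes _)   q@(yes _) lt sh =
    inj₁ (sym (below-contact {dualRect′ m p} {dualRect′ m q} lt sh))
  share⇒up p@(yes i<k) q@(no k≰j) lt sh =
    inj₂ (sym (left-contact {dualRect′ m p} {dualRect′ m q} (≮⇒≥ k≰j) sh) , i<k)
  share⇒up (no p)      (yes q)   lt sh = contradiction (<-trans lt q) p
  share⇒up p@(no _)    q@(no _)  lt sh =
    inj₁ (sym (left-contact {dualRect′ m p} {dualRect′ m q} lt sh))

  up⇒share : ∀ {i j} (p : Dec (i < suc m)) (q : Dec (j < suc m)) → Up (suc m) i j →
             ShareSegment (dualRect′ m p) (dualRect′ m q)
  up⇒share p@(yes _)  q@(yes _) (inj₁ refl)       = abut-y {dualRect′ m p} {dualRect′ m q} refl z<s z<s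
  up⇒share (yes _)    (yes q)   (inj₂ (refl , _)) = contradiction q (<-irrefl refl)
  -- Here `suc i` is forced to be the hub, so `i` is the last row.
  up⇒share p@(yes lt) q@(no ge) (inj₁ refl)       =
    abut-x {dualRect′ m p} {dualRect′ m q} (≤-antisym (≮⇒≥ ge) lt) lt z<s
  up⇒share p@(yes lt) q@(no _)  (inj₂ (refl , _)) = abut-x {dualRect′ m p} {dualRect′ m q} refl lt z<s
  up⇒share (no p)     (yes q)   u                 = contradiction (<-trans (up⇒< {suc m} u) q) p
  up⇒share p@(no _)   q@(no _)  (inj₁ refl)       = abut-x {dualRect′ m p} {dualRect′ m q} refl z<s z<s
  up⇒share (no p)     (no _)    (inj₂ (_ , lt))   = contradiction lt p

-- Pigeonhole on which of `u`, `v`, `w` each element equals; these three may coincide.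
¬4-into-3 : ∀ {A : Set} {i j k l u v w : A} →
            i ≢ j → i ≢ k → i ≢ l → j ≢ k → j ≢ l → k ≢ l →
            let In = λ x → x ≡ u ⊎ x ≡ v ⊎ x ≡ w in
            In i → In j → In k → ¬ In l
¬4-into-3 {A} {i} {j} {k} {l} {u} {v} {w} ij ik il jk jl kl pi pj pk pl =
  let (a , b , a<b , eq) = F.pigeonhole (n<1+n 3) (colour ∘ member)
  in distinct a b a<b (colour-injective (member a) (member b) eq)
  where
  In : A → Set
  In x = x ≡ u ⊎ x ≡ v ⊎ x ≡ w

  elem : Fin 4 → A
  elem F.zero                         = i
  elem (F.suc F.zero)                 = j
  elem (F.suc (F.suc F.zero))         = k
  elem (F.suc (F.suc (F.suc F.zero))) = l

  member : ∀ a → In (elem a)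
  member F.zero                         = pi
  member (F.suc F.zero)                 = pj
  member (F.suc (F.suc F.zero))         = pk
  member (F.suc (F.suc (F.suc F.zero))) = pl

  colour : ∀ {x} → In x → Fin 3
  colour (inj₁ _)        = F.zero
  colour (inj₂ (inj₁ _)) = F.suc F.zero
  colour (inj₂ (inj₂ _)) = F.suc (F.suc F.zero)

  colour-injective : ∀ {x y} (p : In x) (q : In y) → colour p ≡ colour q → x ≡ y
  colour-injective (inj₁ refl)        (inj₁ refl)        _ = refl
  colour-injective (inj₁ _)           (inj₂ (inj₁ _)) ()
  colour-injective (inj₁ _)           (inj₂ (inj₂ _)) ()
  colour-injective (inj₂ (inj₁ refl)) (inj₂ (inj₁ refl)) _ = refl
  colour-injective (inj₂ (inj₂ refl)) (inj₂ (inj₂ refl)) _ = refl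

  distinct : ∀ a b → a F.< b → elem a ≢ elem b
  distinct F.zero         (F.suc F.zero)                 _ = ij
  distinct F.zero         (F.suc (F.suc F.zero))         _ = ik
  distinct F.zero         (F.suc (F.suc (F.suc F.zero))) _ = il
  distinct (F.suc F.zero) (F.suc (F.suc F.zero))         _ = jk
  distinct (F.suc F.zero) (F.suc (F.suc (F.suc F.zero))) _ = jl
  distinct (F.suc (F.suc F.zero)) (F.suc (F.suc (F.suc F.zero))) _ = kl
  distinct (F.suc F.zero) (F.suc F.zero) (s≤s ())
  distinct (F.suc (F.suc F.zero)) (F.suc F.zero) (s≤s ())
  distinct (F.suc (F.suc F.zero)) (F.suc (F.suc F.zero)) (s≤s (s≤s ()))
  distinct (F.suc (F.suc (F.suc F.zero))) (F.suc F.zero) (s≤s ())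
  distinct (F.suc (F.suc (F.suc F.zero))) (F.suc (F.suc F.zero)) (s≤s (s≤s ()))
  distinct (F.suc (F.suc (F.suc F.zero))) (F.suc (F.suc (F.suc F.zero))) (s≤s (s≤s (s≤s ())))

-- The second alternative arises only for `p ≡ suc i`, so `pred` is never taken at zero.
between : ∀ {i p} → i ≤ p → p ≤ suc i → i ≡ p ⊎ i ≡ pred p
between {i} {p} i≤p p≤1+i with m≤n⇒m<n∨m≡n p≤1+i
... | inj₁ p<1+i = inj₁ (≤-antisym i≤p (s≤s⁻¹ p<1+i))
... | inj₂ refl  = inj₂ refl

rectDual : ∀ m → RectDual (fan (suc m))
rectDual m = record
  { rect     = dualRect m ∘ toℕ
  ; outer    = record
      { x1 = 0 ; x2 = suc m + suc (suc m) ; y1 = 0 ; y2 = suc m ; x1<x2 = z<s ; y1<y2 = z<s }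
  ; inside   = λ i → inside (toℕ i <? suc m) (F.toℕ<n i)
  ; covers   = covers
  ; disjoint = λ i j ne → Realises.disjoint-≢ (dual-realises m) (ne ∘ F.toℕ-injective)
  ; no-four  = λ { px py i j k l a b c d e f (p , q , r , s) →
      let (u , v , w , meets) = few px py
          ne = λ {x y : Fin _} (x≢y : x ≢ y) → x≢y ∘ F.toℕ-injective in
      ¬4-into-3 {u = u} {v} {w} (ne a) (ne b) (ne c) (ne d) (ne e) (ne f)
        (meets (toℕ i <? suc m) p) (meets (toℕ j <? suc m) q)
        (meets (toℕ k <? suc m) r) (meets (toℕ l <? suc m) s) }
  ; contact  = Realises.contact (dual-realises m)
  }
  where
  inside : ∀ {i} (p : Dec (i < suc m)) → i < suc m + suc (suc m) →
           (0 ≤ x1 (dualRect′ m p)) × (x2 (dualRect′ m p) ≤ suc m + suc (suc m)) ×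
           (0 ≤ y1 (dualRect′ m p)) × (y2 (dualRect′ m p) ≤ suc m)
  inside (yes p) lt = z≤n , m≤m+n _ _ , z≤n , p
  inside (no p)  lt = z≤n , lt , z≤n , ≤-refl

  covers : ∀ a b → (0 ≤ a) × (a < suc m + suc (suc m)) × (0 ≤ b) × (b < suc m) →
           ∃ λ (i : Fin (suc m + suc (suc m))) → CellIn a b (dualRect m (toℕ i))
  covers a b (_ , a<n , _ , b<k) with a <? suc m
  ... | yes a<k = fromℕ< b<n , subst (CellIn a b ∘ dualRect m) (sym (F.toℕ-fromℕ< b<n)) row
    where
    b<n : b < suc m + suc (suc m)
    b<n = <-≤-trans b<k (m≤m+n _ _)
    row : CellIn a b (dualRect m b)
    row with b <? suc m
    ... | yes _   = z≤n , a<k , ≤-refl , ≤-refl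
    ... | no  b≮k = contradiction b<k b≮k
  ... | no  a≮k = fromℕ< a<n , subst (CellIn a b ∘ dualRect m) (sym (F.toℕ-fromℕ< a<n)) column
    where
    column : CellIn a b (dualRect m a)
    column with a <? suc m
    ... | yes a<k = contradiction a<k a≮k
    ... | no  _   = ≤-refl , ≤-refl , z≤n , b<k

  -- A point with px ≤ k meets at most two rows and the column k; any other point meets only
  -- columns, at most two.
  few : ∀ px py → ∃ λ u → ∃₂ λ v w → ∀ {i} (p : Dec (i < suc m)) →
        PointIn px py (dualRect′ m p) → i ≡ u ⊎ i ≡ v ⊎ i ≡ w
  few px py with px ≤? suc m
  ... | yes px≤k = py , pred py , suc m , meets
    where
    meets : ∀ {i} (p : Dec (i < suc m)) → PointIn px py (dualRect′ m p) →
            i ≡ py ⊎ i ≡ pred py ⊎ i ≡ suc m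
    meets (yes _) (_ , _ , p , q) = [ inj₁ , inj₂ ∘ inj₁ ]′ (between p q)
    meets (no k≤i) (p , _ , _ , _) = inj₂ (inj₂ (≤-antisym (≤-trans p px≤k) (≮⇒≥ k≤i)))
  -- Two candidates suffice here; the repetition pads the list to three.
  ... | no  px≰k = px , pred px , pred px , meets
    where
    meets : ∀ {i} (p : Dec (i < suc m)) → PointIn px py (dualRect′ m p) →
            i ≡ px ⊎ i ≡ pred px ⊎ i ≡ pred px
    meets (yes _) (_ , p , _ , _) = contradiction p px≰k
    meets (no _)  (p , q , _ , _) = [ inj₁ , inj₂ ∘ inj₁ ]′ (between p q)

-- Rectangular duals of the fan.

tail-neighbour : ∀ {k c u} → k < c → Edge k c u → u ≡ suc c ⊎ c ≡ suc u
tail-neighbour k<c (inj₁ (inj₁ eq))        = inj₁ eq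
tail-neighbour k<c (inj₁ (inj₂ (_ , c<k))) = contradiction c<k (<-asym k<c)
tail-neighbour k<c (inj₂ (inj₁ eq))        = inj₂ eq
tail-neighbour k<c (inj₂ (inj₂ (refl , _))) = contradiction k<c (<-irrefl refl)

-- Beyond the hub only path edges remain, so distinct neighbours of `c` are its successor and
-- predecessor. The successor is itself a tail vertex, and `tail-neighbour` there excludes the
-- predecessor of `c`.
tail-no-triangle : ∀ {k c u v} → k < c → Edge k c u → Edge k c v → ¬ Edge k u v
tail-no-triangle k<c cu cv uv with tail-neighbour k<c cu | tail-neighbour k<c cv
... | inj₁ refl | inj₁ refl = edge-irr uv
... | inj₂ refl | inj₂ refl = edge-irr uv
... | inj₁ refl | inj₂ refl with tail-neighbour (m<n⇒m<1+n k<c) uv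
...   | inj₁ ()
...   | inj₂ ()
tail-no-triangle k<c cu cv uv | inj₂ refl | inj₁ refl
  with tail-neighbour (m<n⇒m<1+n k<c) (swap uv)
...   | inj₁ ()
...   | inj₂ ()

tail-triangle-free : ∀ {k} {c : Fin (k + suc k)} → k < toℕ c → TriangleFreeAt (fan k) c
tail-triangle-free {k} {c} k<c u v cu cv uv =
  tail-no-triangle k<c (adj⇒edge {k} {c} {u} cu) (adj⇒edge {k} {c} {v} cv) (adj⇒edge {k} {u} {v} uv)

module _ {m : ℕ} (D : RectDual (fan (suc m))) where
  open RectDual D

  private
    k = suc m

    leaf tail : Fin k → Fin (k + suc k)
    leaf i = i ↑ˡ suc k
    tail i = k ↑ʳ F.suc i

    centre first : Fin (k + suc k)
    centre = k ↑ʳ F.zero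
    first  = tail F.zero

    toℕ-leaf : ∀ i → toℕ (leaf i) ≡ toℕ i
    toℕ-leaf i = F.toℕ-↑ˡ i (suc k)

    toℕ-centre : toℕ centre ≡ k
    toℕ-centre = trans (F.toℕ-↑ʳ k (F.zero {k})) (+-identityʳ k)

    toℕ-tail : ∀ i → toℕ (tail i) ≡ suc (k + toℕ i)
    toℕ-tail i = trans (F.toℕ-↑ʳ k (F.suc i)) (+-suc k (toℕ i))

    toℕ-first : toℕ first ≡ suc k
    toℕ-first = trans (toℕ-tail F.zero) (cong suc (+-identityʳ k))

    k<tail : ∀ i → k < toℕ (tail i)
    k<tail i = subst (k <_) (sym (toℕ-tail i)) (s≤s (m≤m+n k (toℕ i)))

  module _ (first-spans : SpansY D first) where
    private
      -- A tail rectangle spanning horizontally would cross `first` and hence be `first`, which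
      -- spans vertically.
      high-spans : ∀ {c} → k < toℕ c → SpansY D c
      high-spans k<c with spans D (tail-triangle-free k<c)
      ... | inj₁ sx = subst (SpansY D) (sym (crossing-spans D sx first-spans)) first-spans
      ... | inj₂ sy = sy

      ≢-by-toℕ : ∀ {u v : Fin (k + suc k)} → toℕ u < toℕ v → u ≢ v
      ≢-by-toℕ lt refl = <-irrefl refl lt

      centre<first : toℕ centre < toℕ first
      centre<first = subst₂ _<_ (sym toℕ-centre) (sym toℕ-first) (n<1+n k)

      leaf<centre : ∀ i → toℕ (leaf i) < toℕ centre
      leaf<centre i = subst₂ _<_ (sym (toℕ-leaf i)) (sym toℕ-centre) (F.toℕ<n i)

      centre-first : Adj (fan k) centre first
      centre-first = edge⇒adj {k} {centre} {first}
        (inj₁ (inj₁ (trans toℕ-first (cong suc (sym toℕ-centre)))))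

      centre-leaf : ∀ i → Adj (fan k) centre (leaf i)
      centre-leaf i = edge⇒adj {k} {centre} {leaf i}
        (inj₂ (inj₂ (toℕ-centre , subst (toℕ (leaf i) <_) toℕ-centre (leaf<centre i))))

      first-neighbours : ∀ z → Adj (fan k) first z → z ≡ centre ⊎ SpansY D z
      first-neighbours z a with tail-neighbour (k<tail F.zero) (adj⇒edge {k} {first} {z} a)
      ... | inj₁ eq = inj₂ (high-spans (subst (k <_) (sym eq) (m<n⇒m<1+n (k<tail F.zero))))
      ... | inj₂ eq = inj₁ (F.toℕ-injective
            (trans (suc-injective (trans (sym eq) toℕ-first)) (sym toℕ-centre)))

      -- For `k` at least 2 the hub lies in triangles, so `spans` does not apply to it. It inherits
      -- the property from `first`, whose other neighbours are tail rectangles.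
      centre-spans : SpansY D centre
      centre-spans = spans-beside D first-spans (≢-by-toℕ centre<first ∘ sym)
        (Adj-sym (fan k) {centre} {first} centre-first) first-neighbours

    -- Two spanning tail rectangles with the same left side would share a column, so the `k` left
    -- sides are distinct integers within the bounding box.
    k≤width : k ≤ maxF (x2 ∘ rect) ∸ minF (x1 ∘ rect)
    k≤width = injective⇒≤∸ (x1 ∘ rect ∘ tail)
      (λ {i} {j} eq → let (_ , p , q) = common-column D (inj₁ eq) in
        F.suc-injective (F.↑ʳ-injective k _ _ (same-column D (high-spans (k<tail i)) p q)))
      (λ i → minF-≤ (x1 ∘ rect) (tail i))
      (λ i → <-≤-trans (x1<x2 (rect (tail i))) (≤-maxF (x2 ∘ rect) (tail i)))

    k≤height : k ≤ maxF (y2 ∘ rect) ∸ minF (y1 ∘ rect)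
    k≤height = injective⇒≤∸ (y1 ∘ rect ∘ leaf)
      (λ {i} {j} eq → F.↑ˡ-injective (suc k) _ _
        (heights-distinct D centre-spans first-spans (≢-by-toℕ centre<first)
          (≢-by-toℕ (leaf<centre i) ∘ sym) (≢-by-toℕ (leaf<centre j) ∘ sym)
          (≢-by-toℕ (<-trans (leaf<centre i) centre<first) ∘ sym)
          (≢-by-toℕ (<-trans (leaf<centre j) centre<first) ∘ sym)
          centre-first (centre-leaf i) (centre-leaf j) eq))
      (λ i → minF-≤ (y1 ∘ rect) (leaf i))
      (λ i → <-≤-trans (y1<y2 (rect (leaf i))) (≤-maxF (y2 ∘ rect) (leaf i)))

  first-spans : SpansX D first ⊎ SpansY D first
  first-spans = spans D (tail-triangle-free (k<tail F.zero))

k²≤area : ∀ {m} (D : RectDual (fan (suc m))) → suc m * suc m ≤ bboxArea (RectDual.rect D)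
k²≤area D with first-spans D
-- If `first` spans horizontally, it spans vertically in the transposed dual, whose height is the
-- width of `D`.
... | inj₁ sx = *-mono-≤ (k≤height (transposeDual D) sx) (k≤width (transposeDual D) sx)
... | inj₂ sy = *-mono-≤ (k≤width D sy) (k≤height D sy)

theorem12 : Σ ℕ λ c₁ → Σ ℕ λ d → (0 < c₁) × (0 < d) ×
    ((N : ℕ) → Σ ℕ λ n → (N ≤ n) × Σ (Graph n) λ G →
    StrongLayout G × RectDual G
    × (Σ (StrongLayout G) λ L → bboxArea (StrongLayout.rect L) ≤ c₁ * n)
    × ((D : RectDual G) → n * n ≤ d * bboxArea (RectDual.rect D)))
-- The strong layout fits in a box of size 2 by `n`, giving `c₁ = 2`. Since `k` is positive,
-- `n = 2k + 1` is at most `3k`, so `n * n` is at most 9 times `k * k`; in the naturals, `d = 9`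
-- stands for `c₂ = 1/9`.
theorem12 = 2 , 9 , z<s , z<s , λ N → let k = suc N in
    k + suc k , ≤-trans (n≤1+n N) (m≤m+n k (suc k)) , fan k
  , strongLayout k , rectDual N , (strongLayout k , strong-area k)
  , λ D → ≤-trans (*-mono-≤ (n≤3k N) (n≤3k N))
      (≤-trans (≤-reflexive ([m*n]*[o*p]≡[m*o]*[n*p] 3 k 3 k)) (*-monoʳ-≤ 9 (k²≤area D)))
  where
  n≤3k : ∀ m → suc m + suc (suc m) ≤ 3 * suc m
  n≤3k m = +-monoʳ-≤ (suc m) (≤-trans (≤-reflexive (+-comm 1 (suc m)))
    (+-monoʳ-≤ (suc m) (s≤s z≤n)))
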